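{- There is an absolute, effectively computable constant $C>0$ with the following property. If $t\neq 1$ is a root of unity such that the point $P=(2,*)\in E_t(\overline{\mathbf{Q}})$ has finite order, then $[\mathbf{Q}(t):\mathbf{Q}]\le C$.
   Context: For $t\in\overline{\mathbf{Q}}\smallsetminus\{0,1\}$, $E_t$ denotes the elliptic curve in Legendre form $y^2=x(x-1)(x-t)$, with the point at infinity as origin. The notation $(2,*)$ means a point of $E_t$ with abscissa ($x$-coordinate) $2$, i.e. $(2,\pm\sqrt{4-2t})$; the choice of sign does not affect whether it has finite order. -}

module Defs where

open import Algebra.Apartness.Bundles using (HeytingField)
open import Algebra.Bundles using (CommutativeRing; Semiring)
open import Algebra.Bundles.Raw using (RawMonoid)
import Algebra.Definitions.RawMonoid
import Algebra.Definitions.RawSemiring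
open import Algebra.Morphism.Structures using (module RingMorphisms)
import Algebra.Solver.Ring
open import Algebra.Solver.Ring.AlmostCommutativeRing
  using (fromCommutativeRing; _-Raw-AlmostCommutative⟶_)
open import Data.Empty using (⊥)
open import Data.Fin.Base using (toℕ)
open import Data.Maybe.Base as Maybe using (Maybe)
open import Data.Nat.Base as ℕ using (ℕ)
open import Data.Product.Base using (∃; ∃-syntax; _×_; _,_; proj₁)
open import Data.Rational.Base as ℚ using (ℚ; 0ℚ)
import Data.Rational.Properties as ℚ
open import Data.Vec.Functional using (Vector)
open import Function.Base using (_∘_)
open import Level using (0ℓ)
open import Relation.Binary.Consequences using (dec⇒weaklyDec)
open import Relation.Binary.Definitions using (Decidable)
open import Relation.Binary.PropositionalEquality.Core using (_≡_; _≢_)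
import Relation.Binary.PropositionalEquality.Core as ≡
import Relation.Binary.Reasoning.Setoid
open import Relation.Nullary.Decidable.Core using (yes; no)
open import Relation.Unary using (Pred)

-- An algebraic closure of ℚ: a (discrete) field extension of ℚ which is
-- algebraic over ℚ and algebraically closed.  The apartness _#_ is
-- decidable and tight, so it is just the negation of _≈_.
record AlgebraicClosureOfℚ : Set₁ where
  field
    heytingField : HeytingField 0ℓ 0ℓ 0ℓ

  open HeytingField heytingField public
    using (_#_; #⇒invertible; tight)

  commutativeRing : CommutativeRing 0ℓ 0ℓ
  commutativeRing = record
    { isCommutativeRing = HeytingField.isCommutativeRing heytingField }

  open CommutativeRing commutativeRing public
    hiding (isCommutativeRing)
  open Algebra.Definitions.RawSemiring (Semiring.rawSemiring semiring) public
    using (_^_; sum)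

  -- the value at x of the polynomial p₀ + p₁X + … + pₙ₋₁Xⁿ⁻¹
  evalPoly : ∀ {n} → Vector Carrier n → Carrier → Carrier
  evalPoly p x = sum (λ i → p i * x ^ toℕ i)

  infix 4 _#?_
  field
    _#?_ : Decidable _#_
    ι : ℚ → Carrier
    ι-isRingHomomorphism :
      RingMorphisms.IsRingHomomorphism ℚ.+-*-rawRing rawRing ι
    algebraic : ∀ x → ∃[ n ] ∃[ p ]
      (∃[ i ] p i ≢ 0ℚ) × evalPoly {n} (ι ∘ p) x ≈ 0#
    algebraicallyClosed : ∀ {n} (p : Vector Carrier n) →
      (∃[ i ] 0 ℕ.< toℕ i × p i ≉ 0#) → ∃[ x ] evalPoly p x ≈ 0#

module _ (Q̄ : AlgebraicClosureOfℚ) where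
  open AlgebraicClosureOfℚ Q̄

  IsRootOfUnity : Pred Carrier 0ℓ
  IsRootOfUnity t = ∃[ n ] 0 ℕ.< n × t ^ n ≈ 1#

  -- ℚ⟨ t ⟩ is the subfield ℚ(t), as a predicate on Q̄.
  data ℚ⟨_⟩ (t : Carrier) : Pred Carrier 0ℓ where
    resp      : ∀ {x y} → x ≈ y → ℚ⟨ t ⟩ x → ℚ⟨ t ⟩ y
    scalar    : ∀ q → ℚ⟨ t ⟩ (ι q)
    generator : ℚ⟨ t ⟩ t
    plus      : ∀ {x y} → ℚ⟨ t ⟩ x → ℚ⟨ t ⟩ y → ℚ⟨ t ⟩ (x + y)
    minus     : ∀ {x} → ℚ⟨ t ⟩ x → ℚ⟨ t ⟩ (- x)
    times     : ∀ {x y} → ℚ⟨ t ⟩ x → ℚ⟨ t ⟩ y → ℚ⟨ t ⟩ (x * y)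
    inverse   : ∀ {x y} → x * y ≈ 1# → ℚ⟨ t ⟩ x → ℚ⟨ t ⟩ y

  linComb : ∀ {d} → Vector ℚ d → Vector Carrier d → Carrier
  linComb c b = sum (λ i → ι (c i) * b i)

  record IsBasis (t : Carrier) {d : ℕ} (b : Vector Carrier d) : Set where
    field
      elements    : ∀ i → ℚ⟨ t ⟩ (b i)
      independent : ∀ c → linComb c b ≈ 0# → ∀ i → c i ≡ 0ℚ
      spanning    : ∀ {x} → ℚ⟨ t ⟩ x → ∃[ c ] x ≈ linComb c b

  HasDegree : Carrier → ℕ → Set
  HasDegree t d = ∃ (IsBasis t {d})

  ι-morphism : ℚ.+-*-rawRing -Raw-AlmostCommutative⟶
               fromCommutativeRing commutativeRing
  ι-morphism = record
    { ⟦_⟧    = ι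
    ; +-homo = ι.+-homo
    ; *-homo = ι.*-homo
    ; -‿homo = ι.-‿homo
    ; 0-homo = ι.0#-homo
    ; 1-homo = ι.1#-homo
    }
    where module ι = RingMorphisms.IsRingHomomorphism ι-isRingHomomorphism

  ι-≟ : ∀ p q → Maybe (ι p ≈ ι q)
  ι-≟ p q = Maybe.map (reflexive ∘ ≡.cong ι) (dec⇒weaklyDec ℚ._≟_ p q)

  module Solver = Algebra.Solver.Ring ℚ.+-*-rawRing
    (fromCommutativeRing commutativeRing) ι-morphism ι-≟

  -- The curve E_t is smooth, and its addition a group law, for t ≠ 0, 1.
  module Legendre (t : Carrier) where

    cubic : Carrier → Carrier
    cubic x = x * (x - 1#) * (x - t)

    cubic′ : Carrier → Carrier
    cubic′ x = (x - 1#) * (x - t) + x * (x - t) + x * (x - 1#)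

    OnCurve : Carrier → Carrier → Set
    OnCurve x y = y * y ≈ cubic x

    -- The line of slope m through (x₁ , y₁), which meets the curve at
    -- abscissae x₁ and x₂, meets it a third time at abscissa
    -- m² + (1 + t) - x₁ - x₂; the sum is the reflection of that point.
    sumX : (m x₁ x₂ : Carrier) → Carrier
    sumX m x₁ x₂ = m * m + (1# + t) - x₁ - x₂

    sumY : (m x₁ y₁ x₂ : Carrier) → Carrier
    sumY m x₁ y₁ x₂ = - (y₁ + m * (sumX m x₁ x₂ - x₁))

    open Solver using (Polynomial; solve; _:=_; _:+_; _:*_; _:-_; :-_)
    open Relation.Binary.Reasoning.Setoid setoid

    difference≈0 : ∀ {x y} → x ≈ y → x - y ≈ 0#
    difference≈0 {x} {y} x≈y = trans (+-congʳ x≈y) (-‿inverseʳ y)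

    ≈-from-difference : ∀ {x y} → x - y ≈ 0# → x ≈ y
    ≈-from-difference {x} {y} x-y≈0 = begin
      x           ≈⟨ solve 2 (λ x y → x := (x :- y) :+ y) refl x y ⟩
      x - y + y   ≈⟨ +-congʳ x-y≈0 ⟩
      0# + y      ≈⟨ +-identityˡ y ⟩
      y           ∎

    cubicₛ cubic′ₛ : ∀ {n} → (u t x : Polynomial n) → Polynomial n
    cubicₛ u t x = x :* (x :- u) :* (x :- t)
    cubic′ₛ u t x = (x :- u) :* (x :- t) :+ x :* (x :- t) :+ x :* (x :- u)

    sumXₛ : ∀ {n} → (u t m x₁ x₂ : Polynomial n) → Polynomial n
    sumXₛ u t m x₁ x₂ = m :* m :+ (u :+ t) :- x₁ :- x₂

    sumYₛ : ∀ {n} → (u t m x₁ y₁ x₂ : Polynomial n) → Polynomial n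
    sumYₛ u t m x₁ y₁ x₂ = :- (y₁ :+ m :* (sumXₛ u t m x₁ x₂ :- x₁))

    chord-onCurve : ∀ {x₁ y₁ x₂ y₂ m k} →
      OnCurve x₁ y₁ → OnCurve x₂ y₂ →
      k * (x₁ - x₂) ≈ 1# → m * (x₁ - x₂) ≈ y₁ - y₂ →
      OnCurve (sumX m x₁ x₂) (sumY m x₁ y₁ x₂)
    chord-onCurve {x₁} {y₁} {x₂} {y₂} {m} {k} e₁ e₂ kd≈1 md≈ =
      ≈-from-difference (begin
        g                    ≈⟨ *-identityˡ g ⟨
        1# * g               ≈⟨ *-congʳ kd≈1 ⟨
        k * (x₁ - x₂) * g    ≈⟨ *-assoc k (x₁ - x₂) g ⟩
        k * ((x₁ - x₂) * g)  ≈⟨ *-congˡ identity ⟩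
        k * ((y₁ * y₁ - cubic x₁) * (X - x₂) -
             (Y₂ * Y₂ - cubic x₂) * (X - x₁))
          ≈⟨ *-congˡ (+-cong (*-congʳ (difference≈0 e₁))
               (-‿cong (*-congʳ (difference≈0 e₂′)))) ⟩
        k * (0# * (X - x₂) - 0# * (X - x₁))
          ≈⟨ *-congˡ (+-cong (zeroˡ _) (-‿cong (zeroˡ _))) ⟩
        k * (0# - 0#)        ≈⟨ *-congˡ (-‿inverseʳ 0#) ⟩
        k * 0#               ≈⟨ zeroʳ k ⟩
        0#                   ∎)
      where
      X  = sumX m x₁ x₂
      Y  = sumY m x₁ y₁ x₂
      Y₂ = y₁ - m * (x₁ - x₂)
      g  = Y * Y - cubic X

      Y₂≈y₂ : Y₂ ≈ y₂
      Y₂≈y₂ = trans (+-congˡ (-‿cong md≈))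
        (solve 2 (λ y₁ y₂ → y₁ :- (y₁ :- y₂) := y₂) refl y₁ y₂)

      e₂′ : OnCurve x₂ Y₂
      e₂′ = trans (*-cong Y₂≈y₂ Y₂≈y₂) e₂

      identity : (x₁ - x₂) * g ≈
        (y₁ * y₁ - cubic x₁) * (X - x₂) - (Y₂ * Y₂ - cubic x₂) * (X - x₁)
      identity = solve 6 (λ u t m x₁ y₁ x₂ →
        let X  = sumXₛ u t m x₁ x₂
            Y  = sumYₛ u t m x₁ y₁ x₂
            Y₂ = y₁ :- m :* (x₁ :- x₂)
        in (x₁ :- x₂) :* (Y :* Y :- cubicₛ u t X) :=
           (y₁ :* y₁ :- cubicₛ u t x₁) :* (X :- x₂) :-
           (Y₂ :* Y₂ :- cubicₛ u t x₂) :* (X :- x₁))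
        refl 1# t m x₁ y₁ x₂

    tangent-onCurve : ∀ {x₁ y₁ m} → OnCurve x₁ y₁ →
      m * (y₁ + y₁) ≈ cubic′ x₁ →
      OnCurve (sumX m x₁ x₁) (sumY m x₁ y₁ x₁)
    tangent-onCurve {x₁} {y₁} {m} e₁ 2my≈ =
      ≈-from-difference (begin
        Y * Y - cubic X
          ≈⟨ identity ⟩
        (y₁ * y₁ - cubic x₁) + (X - x₁) * (m * (y₁ + y₁) - cubic′ x₁)
          ≈⟨ +-cong (difference≈0 e₁) (*-congˡ (difference≈0 2my≈)) ⟩
        0# + (X - x₁) * 0#
          ≈⟨ trans (+-identityˡ _) (zeroʳ _) ⟩
        0# ∎)
      where
      X = sumX m x₁ x₁
      Y = sumY m x₁ y₁ x₁

      identity : Y * Y - cubic X ≈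
        (y₁ * y₁ - cubic x₁) + (X - x₁) * (m * (y₁ + y₁) - cubic′ x₁)
      identity = solve 5 (λ u t m x₁ y₁ →
        let X = sumXₛ u t m x₁ x₁
            Y = sumYₛ u t m x₁ y₁ x₁
        in Y :* Y :- cubicₛ u t X :=
           (y₁ :* y₁ :- cubicₛ u t x₁) :+
           (X :- x₁) :* (m :* (y₁ :+ y₁) :- cubic′ₛ u t x₁))
        refl 1# t m x₁ y₁

    cubic-cong : ∀ {x y} → x ≈ y → cubic x ≈ cubic y
    cubic-cong x≈y = *-cong (*-cong x≈y (+-congʳ x≈y)) (+-congʳ x≈y)

    -- Two points with the same abscissa which are not opposite are equal.
    same-ordinate : ∀ {x₁ y₁ x₂ y₂ k} → OnCurve x₁ y₁ → OnCurve x₂ y₂ →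
      x₁ ≈ x₂ → k * (y₁ - - y₂) ≈ 1# → y₁ ≈ y₂
    same-ordinate {x₁} {y₁} {x₂} {y₂} {k} e₁ e₂ x₁≈x₂ ks≈1 =
      ≈-from-difference (begin
        y₁ - y₂                      ≈⟨ *-identityˡ _ ⟨
        1# * (y₁ - y₂)               ≈⟨ *-congʳ ks≈1 ⟨
        k * (y₁ - - y₂) * (y₁ - y₂)
          ≈⟨ solve 3 (λ k y₁ y₂ → k :* (y₁ :- :- y₂) :* (y₁ :- y₂) :=
               k :* (y₁ :* y₁ :- y₂ :* y₂)) refl k y₁ y₂ ⟩
        k * (y₁ * y₁ - y₂ * y₂)
          ≈⟨ *-congˡ (difference≈0 (trans e₁ (trans (cubic-cong x₁≈x₂) (sym e₂)))) ⟩
        k * 0#                       ≈⟨ zeroʳ k ⟩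
        0#                           ∎)

    data Point : Set where
      O      : Point
      affine : ∀ x y → OnCurve x y → Point

    infix 4 _≈ₚ_
    data _≈ₚ_ : Point → Point → Set where
      O≈O     : O ≈ₚ O
      affine≈ : ∀ {x y x′ y′ e e′} → x ≈ x′ → y ≈ y′ →
                affine x y e ≈ₚ affine x′ y′ e′

    cancel : ∀ {n d k} → k * d ≈ 1# → n * k * d ≈ n
    cancel {n} kd≈1 =
      trans (*-assoc _ _ _) (trans (*-congˡ kd≈1) (*-identityʳ n))

    infixl 6 _+ₚ_
    _+ₚ_ : Point → Point → Point
    O               +ₚ Q               = Q
    affine x y e    +ₚ O               = affine x y e
    affine x₁ y₁ e₁ +ₚ affine x₂ y₂ e₂ with x₁ #? x₂
    ... | yes x₁#x₂ =
      let k , kd≈1 , _ = #⇒invertible x₁#x₂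
          m = (y₁ - y₂) * k
      in affine (sumX m x₁ x₂) (sumY m x₁ y₁ x₂)
           (chord-onCurve e₁ e₂ kd≈1 (cancel kd≈1))
    ... | no ¬x₁#x₂ with y₁ #? - y₂
    ...   | no _ = O
    ...   | yes y₁#-y₂ =
      -- here y₁ ≈ y₂, so that k inverts 2y₁
      let k , ks≈1 , _ = #⇒invertible y₁#-y₂
          m = cubic′ x₁ * k
          y₁≈y₂ = same-ordinate e₁ e₂ (proj₁ (tight x₁ x₂) ¬x₁#x₂) ks≈1
          y₁≈--y₂ = trans y₁≈y₂ (solve 1 (λ y → y := :- :- y) refl y₂)
      in affine (sumX m x₁ x₁) (sumY m x₁ y₁ x₁)
           (tangent-onCurve e₁
             (trans (*-congˡ (+-congˡ y₁≈--y₂)) (cancel ks≈1)))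

    rawMonoid : RawMonoid 0ℓ 0ℓ
    rawMonoid = record { _≈_ = _≈ₚ_ ; _∙_ = _+ₚ_ ; ε = O }

    private module Multiple = Algebra.Definitions.RawMonoid rawMonoid

    HasFiniteOrder : Pred Point 0ℓ
    HasFiniteOrder P = ∃[ n ] 0 ℕ.< n × n Multiple.× P ≈ₚ O

    HasAbscissa : Carrier → Pred Point 0ℓ
    HasAbscissa a O              = ⊥
    HasAbscissa a (affine x _ _) = x ≈ a

-- The point P = (2 , y₁) never has finite order, by a 2-adic argument: since
-- t is a unit at 2, the abscissa (4 - t)² / 8(2 - t) of 2P has a pole there,
-- so 2P lies deep in the formal group, where there is no torsion.  Instead
-- of a valuation we use R, the localisation of ℤ[t] at 1 + 2ℤ[t]; by Nakayama's
-- lemma 2 is not invertible in R, as ℤ[t] is finite over ℤ.  Each even multiple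
-- (x , y) of P is O or satisfies 1/x ∈ 8R and x/y ∈ 2y₁R, and each odd multiple
-- lies in (2 + 8R) × y₁(1 + 2R).  If nP = O then n is even, because odd
-- multiples are affine; so with n = 2m we have mP = -mP, hence mP is O or has
-- ordinate 0.  The latter is impossible, and the former descends from n to m.
module Submission where

open import Defs
open import Algebra.Bundles using (CommutativeRing)
import Algebra.Definitions.RawMonoid
open import Algebra.Morphism.Structures using (module RingMorphisms)
import Algebra.Properties.Ring
import Algebra.Properties.Semiring.Mult.TCOptimised
import Algebra.Solver.Ring
open import Algebra.Solver.Ring.AlmostCommutativeRing
  using (fromCommutativeRing; _-Raw-AlmostCommutative⟶_)
open import Data.Integer.Base as ℤ using (ℤ; +_; -[1+_]; _⊖_)
import Data.Integer.Properties as ℤ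
import Data.Integer.Solver
open import Data.List.Base using (List; []; _∷_; applyUpTo)
open import Data.List.Membership.Propositional using (_∈_)
open import Data.List.Membership.Propositional.Properties
  using (∈-applyUpTo⁺; ∈-applyUpTo⁻)
open import Data.List.Relation.Unary.All as All using (All; []; _∷_)
open import Data.List.Relation.Unary.Any using (here; there)
open import Data.Maybe.Base as Maybe using (Maybe)
open import Data.Nat.Base as ℕ using (ℕ; zero; suc; _≤_; _<_; z≤n; s≤s)
open import Data.Nat.Induction using (<-rec)
import Data.Nat.Properties as ℕ
open import Data.Product.Base using (Σ-syntax; ∃-syntax; _×_; _,_; proj₁; proj₂)
open import Data.Rational.Base as ℚ using (ℚ; 0ℚ; 1ℚ)
import Data.Rational.Properties as ℚ
open import Data.Sum.Base using (inj₁; inj₂)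
open import Function.Base using (_∘_)
open import Level using (0ℓ)
open import Relation.Binary.Consequences using (dec⇒weaklyDec)
open import Relation.Binary.PropositionalEquality.Core as ≡ using (_≡_; _≢_)
import Relation.Binary.Reasoning.Setoid
open import Relation.Nullary.Decidable.Core using (yes; no)
open import Relation.Nullary.Negation.Core using (¬_; contradiction)

-- A ring solver whose constants are the integers of the ring itself: unlike
-- `Defs.Solver`, it identifies its constant 1 with 1#.
module IntegerCoefficients (R : CommutativeRing 0ℓ 0ℓ) where
  open CommutativeRing R
  open Algebra.Properties.Semiring.Mult.TCOptimised semiring
    using (×-homo-+; ×1-homo-*; 1+×) renaming (_×_ to _·_)
  open Algebra.Properties.Ring ring
    using (-0#≈0#; -‿involutive; -‿distribˡ-*; -‿distribʳ-*; -‿+-comm)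
  open Relation.Binary.Reasoning.Setoid setoid

  fromℤ : ℤ → Carrier
  fromℤ (+ n)    = n · 1#
  fromℤ -[1+ n ] = - (suc n · 1#)

  -- The mixed-sign cases of `fromℤ-+` reduce to this; each step cancels one `1#` on both sides.
  fromℤ-⊖ : ∀ m n → fromℤ (m ⊖ n) ≈ m · 1# - n · 1#
  fromℤ-⊖ m zero = begin
    m · 1#       ≈⟨ +-identityʳ _ ⟨
    m · 1# + 0#  ≈⟨ +-congˡ -0#≈0# ⟨
    m · 1# - 0#  ∎
  fromℤ-⊖ zero    (suc n) = sym (+-identityˡ _)
  fromℤ-⊖ (suc m) (suc n) = begin
    fromℤ (suc m ⊖ suc n)          ≡⟨ ≡.cong fromℤ (ℤ.[1+m]⊖[1+n]≡m⊖n m n) ⟩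
    fromℤ (m ⊖ n)                  ≈⟨ fromℤ-⊖ m n ⟩
    m · 1# - n · 1#                ≈⟨ +-identityˡ _ ⟨
    0# + (m · 1# - n · 1#)         ≈⟨ +-congʳ (-‿inverseʳ 1#) ⟨
    1# - 1# + (m · 1# - n · 1#)    ≈⟨ +-assoc _ _ _ ⟩
    1# + (- 1# + (m · 1# - n · 1#))
      ≈⟨ +-congˡ (trans (sym (+-assoc _ _ _))
           (trans (+-congʳ (+-comm _ _)) (+-assoc _ _ _))) ⟩
    1# + (m · 1# + (- 1# - n · 1#)) ≈⟨ +-assoc _ _ _ ⟨
    1# + m · 1# + (- 1# - n · 1#)   ≈⟨ +-congˡ (-‿+-comm _ _) ⟩
    1# + m · 1# - (1# + n · 1#)     ≈⟨ +-cong (1+× m 1#) (-‿cong (1+× n 1#)) ⟨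
    suc m · 1# - suc n · 1#         ∎

  fromℤ-neg : ∀ i → fromℤ (ℤ.- i) ≈ - fromℤ i
  fromℤ-neg (+ zero)  = sym -0#≈0#
  fromℤ-neg (+ suc n) = refl
  fromℤ-neg -[1+ n ]  = sym (-‿involutive _)

  fromℤ-+ : ∀ i j → fromℤ (i ℤ.+ j) ≈ fromℤ i + fromℤ j
  fromℤ-+ (+ m)    (+ n)    = ×-homo-+ 1# m n
  fromℤ-+ (+ m)    -[1+ n ] = fromℤ-⊖ m (suc n)
  fromℤ-+ -[1+ m ] (+ n)    = trans (fromℤ-⊖ n (suc m)) (+-comm _ _)
  fromℤ-+ -[1+ m ] -[1+ n ] = begin
    - (suc (suc (m ℕ.+ n)) · 1#)
      ≡⟨ ≡.cong (λ k → - (k · 1#)) (ℕ.+-suc (suc m) n) ⟨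
    - ((suc m ℕ.+ suc n) · 1#)        ≈⟨ -‿cong (×-homo-+ 1# (suc m) (suc n)) ⟩
    - (suc m · 1# + suc n · 1#)       ≈⟨ -‿+-comm _ _ ⟨
    - (suc m · 1#) - (suc n · 1#)     ∎

  fromℤ-pos-* : ∀ m j → fromℤ (+ m ℤ.* j) ≈ fromℤ (+ m) * fromℤ j
  fromℤ-pos-* m (+ n) =
    trans (reflexive (≡.cong fromℤ (≡.sym (ℤ.pos-* m n)))) (×1-homo-* m n)
  fromℤ-pos-* m -[1+ n ] = begin
    fromℤ (+ m ℤ.* ℤ.- + suc n)
      ≡⟨ ≡.cong fromℤ (ℤ.neg-distribʳ-* (+ m) (+ suc n)) ⟨
    fromℤ (ℤ.- (+ m ℤ.* + suc n))
      ≡⟨ ≡.cong (λ i → fromℤ (ℤ.- i)) (ℤ.pos-* m (suc n)) ⟨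
    fromℤ (ℤ.- + (m ℕ.* suc n))  ≈⟨ fromℤ-neg (+ (m ℕ.* suc n)) ⟩
    - ((m ℕ.* suc n) · 1#)       ≈⟨ -‿cong (×1-homo-* m (suc n)) ⟩
    - (m · 1# * suc n · 1#)      ≈⟨ -‿distribʳ-* _ _ ⟩
    m · 1# * - (suc n · 1#)      ∎

  fromℤ-* : ∀ i j → fromℤ (i ℤ.* j) ≈ fromℤ i * fromℤ j
  fromℤ-* (+ m)    j = fromℤ-pos-* m j
  fromℤ-* -[1+ m ] j = begin
    fromℤ (ℤ.- + suc m ℤ.* j)    ≡⟨ ≡.cong fromℤ (ℤ.neg-distribˡ-* (+ suc m) j) ⟨
    fromℤ (ℤ.- (+ suc m ℤ.* j))  ≈⟨ fromℤ-neg (+ suc m ℤ.* j) ⟩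
    - fromℤ (+ suc m ℤ.* j)      ≈⟨ -‿cong (fromℤ-pos-* (suc m) j) ⟩
    - (suc m · 1# * fromℤ j)     ≈⟨ -‿distribˡ-* _ _ ⟩
    - (suc m · 1#) * fromℤ j     ∎

  fromℤ-morphism : ℤ.+-*-rawRing -Raw-AlmostCommutative⟶ fromCommutativeRing R
  fromℤ-morphism = record
    { ⟦_⟧    = fromℤ
    ; +-homo = fromℤ-+
    ; *-homo = fromℤ-*
    ; -‿homo = fromℤ-neg
    ; 0-homo = refl
    ; 1-homo = refl
    }

  fromℤ-≟ : ∀ i j → Maybe (fromℤ i ≈ fromℤ j)
  fromℤ-≟ i j = Maybe.map (reflexive ∘ ≡.cong fromℤ) (dec⇒weaklyDec ℤ._≟_ i j)

  open Algebra.Solver.Ring ℤ.+-*-rawRing (fromCommutativeRing R)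
    fromℤ-morphism fromℤ-≟ public
    using (Polynomial; solve; con; _:=_; _:+_; _:*_; _:-_; :-_)

  lit : ∀ {n} → ℕ → Polynomial n
  lit k = con (+ k)

  2# : Carrier
  2# = fromℤ (+ 2)

-- Field arithmetic and characteristic zero.

module Field (Q̄ : AlgebraicClosureOfℚ) where
  open AlgebraicClosureOfℚ Q̄
  open IntegerCoefficients commutativeRing public
  open Relation.Binary.Reasoning.Setoid setoid

  sub≈0 : ∀ {x y} → x ≈ y → x - y ≈ 0#
  sub≈0 x≈y = trans (+-congʳ x≈y) (-‿inverseʳ _)

  sub≈0⇒≈ : ∀ {x y} → x - y ≈ 0# → x ≈ y
  sub≈0⇒≈ {x} {y} x-y≈0 = begin
    x           ≈⟨ solve 2 (λ x y → x := (x :- y) :+ y) refl x y ⟩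
    x - y + y   ≈⟨ +-congʳ x-y≈0 ⟩
    0# + y      ≈⟨ +-identityˡ y ⟩
    y           ∎

  -- An equation follows from others once the difference of its sides is
  -- a combination of theirs, which is a polynomial identity.
  combine₁ : ∀ {l r c a b} → l - r ≈ c * (a - b) → a ≈ b → l ≈ r
  combine₁ eq a≈b = sub≈0⇒≈ (trans eq (trans (*-congˡ (sub≈0 a≈b)) (zeroʳ _)))

  combine₂ : ∀ {l r c a b c′ a′ b′} →
    l - r ≈ c * (a - b) + c′ * (a′ - b′) → a ≈ b → a′ ≈ b′ → l ≈ r
  combine₂ eq h h′ = sub≈0⇒≈ (trans eq (trans
    (+-cong (trans (*-congˡ (sub≈0 h)) (zeroʳ _)) (trans (*-congˡ (sub≈0 h′)) (zeroʳ _)))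
    (+-identityˡ _)))

  combine₃ : ∀ {l r c a b c′ a′ b′ c″ a″ b″} →
    l - r ≈ c * (a - b) + c′ * (a′ - b′) + c″ * (a″ - b″) →
    a ≈ b → a′ ≈ b′ → a″ ≈ b″ → l ≈ r
  combine₃ eq h h′ h″ = sub≈0⇒≈ (trans eq (trans
    (+-cong (trans (+-cong (trans (*-congˡ (sub≈0 h)) (zeroʳ _))
                           (trans (*-congˡ (sub≈0 h′)) (zeroʳ _))) (+-identityˡ _))
            (trans (*-congˡ (sub≈0 h″)) (zeroʳ _)))
    (+-identityˡ _)))

  invertible⇒cancelˡ : ∀ {k a x y} → k * a ≈ 1# → a * x ≈ a * y → x ≈ y
  invertible⇒cancelˡ {k} {a} {x} {y} ka≈1 ax≈ay = combine₂
    (solve 4 (λ k a x y → x :- y :=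
      (y :- x) :* (k :* a :- lit 1) :+ k :* (a :* x :- a :* y)) refl k a x y)
    ka≈1 ax≈ay

  ≉0⇒invertible : ∀ {x} → x ≉ 0# → ∃[ k ] k * x ≈ 1#
  ≉0⇒invertible {x} x≉0 with x #? 0#
  ... | no ¬x#0 = contradiction (proj₁ (tight x 0#) ¬x#0) x≉0
  ... | yes x#0 with k , k[x-0]≈1 , _ ← #⇒invertible x#0 = k ,
    trans (solve 2 (λ k x → k :* x := k :* (x :- lit 0)) refl k x) k[x-0]≈1

  *-≉0 : ∀ {x y} → x ≉ 0# → y ≉ 0# → x * y ≉ 0#
  *-≉0 x≉0 y≉0 xy≈0 with k , kx≈1 ← ≉0⇒invertible x≉0 =
    y≉0 (invertible⇒cancelˡ kx≈1 (trans xy≈0 (sym (zeroʳ _))))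

  module _ (1≉0 : 1# ≉ 0#) where
    open RingMorphisms.IsRingHomomorphism ι-isRingHomomorphism
      using (+-homo; *-homo; 0#-homo; 1#-homo)
    open Algebra.Properties.Semiring.Mult.TCOptimised semiring
      using () renaming (_×_ to _·_; ×ᵤ≈× to ·ᵤ≈·)
    open Algebra.Definitions.RawMonoid +-rawMonoid using () renaming (_×_ to _·ᵤ_)

    -- Follows the recursion of `_·ᵤ_`, so that `ι` can be pushed through it by induction.
    fromℕℚ : ℕ → ℚ
    fromℕℚ zero    = 0ℚ
    fromℕℚ (suc n) = 1ℚ ℚ.+ fromℕℚ n

    fromℕℚ-nonNegative : ∀ n → ℚ.NonNegative (fromℕℚ n)
    fromℕℚ-nonNegative zero    = _
    fromℕℚ-nonNegative (suc n) =
      ℚ.nonNeg+nonNeg⇒nonNeg 1ℚ (fromℕℚ n) {{fromℕℚ-nonNegative n}}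

    ι-fromℕℚ : ∀ n → ι (fromℕℚ n) ≈ n ·ᵤ 1#
    ι-fromℕℚ zero    = 0#-homo
    ι-fromℕℚ (suc n) = trans (+-homo 1ℚ (fromℕℚ n)) (+-cong 1#-homo (ι-fromℕℚ n))

    -- Characteristic zero comes from ℚ: `ι` carries the inverse of `suc n` into the field, so a
    -- vanishing image would give 1 = 0.
    suc-×1≉0 : ∀ n → suc n · 1# ≉ 0#
    suc-×1≉0 n sn≈0 = 1≉0 (begin
      1#                 ≈⟨ 1#-homo ⟨
      ι 1ℚ               ≡⟨ ≡.cong ι (ℚ.*-inverseˡ q) ⟨
      ι (ℚ.1/ q ℚ.* q)   ≈⟨ *-homo (ℚ.1/ q) q ⟩
      ι (ℚ.1/ q) * ι q   ≈⟨ *-congˡ (trans (ι-fromℕℚ (suc n)) (trans (·ᵤ≈· (suc n) 1#) sn≈0)) ⟩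
      ι (ℚ.1/ q) * 0#    ≈⟨ zeroʳ _ ⟩
      0#                 ∎)
      where
      q = fromℕℚ (suc n)
      instance
        q-nonZero : ℚ.NonZero q
        q-nonZero = ℚ.pos⇒nonZero q {{ℚ.pos+nonNeg⇒pos 1ℚ (fromℕℚ n) {{fromℕℚ-nonNegative n}}}}

    fromℤ-≉0 : ∀ {i} → i ≢ + 0 → fromℤ i ≉ 0#
    fromℤ-≉0 {+ zero}    i≢0 = λ _ → i≢0 ≡.refl
    fromℤ-≉0 {+ suc n}   _   = suc-×1≉0 n
    fromℤ-≉0 { -[1+ n ]} _ e = suc-×1≉0 n (combine₁
      (solve 1 (λ x → x :- lit 0 := (:- lit 1) :* ((:- x) :- lit 0)) refl _) e)

  -- Finitely generated ℤ-modules and Nakayama's lemma at 2.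

  -- Coefficients are peeled off one generator at a time, the form in which elimination removes the
  -- head of the list.
  Span : List Carrier → Carrier → Set
  Span []       x = x ≈ 0#
  Span (v ∷ vs) x = ∃[ c ] ∃[ x′ ] (x ≈ fromℤ c * v + x′) × Span vs x′

  Span-resp : ∀ vs {x y} → x ≈ y → Span vs x → Span vs y
  Span-resp []       x≈y x≈0                = trans (sym x≈y) x≈0
  Span-resp (v ∷ vs) x≈y (c , x′ , eq , sx′) = c , x′ , trans (sym x≈y) eq , sx′

  Span-0 : ∀ vs → Span vs 0#
  Span-0 []       = refl
  Span-0 (v ∷ vs) = + 0 , 0# , solve 1 (λ v → lit 0 := lit 0 :* v :+ lit 0) refl v , Span-0 vs

  Span-+ : ∀ vs {x y} → Span vs x → Span vs y → Span vs (x + y)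
  Span-+ []       x≈0 y≈0 = trans (+-cong x≈0 y≈0) (+-identityˡ _)
  Span-+ (v ∷ vs) (c , x′ , eqx , sx) (d , y′ , eqy , sy) =
    c ℤ.+ d , x′ + y′ ,
    trans (+-cong eqx eqy) (trans
      (solve 5 (λ c v x d y → (c :* v :+ x) :+ (d :* v :+ y) := (c :+ d) :* v :+ (x :+ y)) refl
        (fromℤ c) v x′ (fromℤ d) y′)
      (+-congʳ (*-congʳ (sym (fromℤ-+ c d))))) ,
    Span-+ vs sx sy

  Span-scale : ∀ vs k {x} → Span vs x → Span vs (fromℤ k * x)
  Span-scale []       k x≈0 = trans (*-congˡ x≈0) (zeroʳ _)
  Span-scale (v ∷ vs) k (c , x′ , eq , sx) =
    k ℤ.* c , fromℤ k * x′ ,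
    trans (*-congˡ eq) (trans
      (solve 4 (λ k c v x → k :* (c :* v :+ x) := (k :* c) :* v :+ k :* x) refl
        (fromℤ k) (fromℤ c) v x′)
      (+-congʳ (*-congʳ (sym (fromℤ-* k c))))) ,
    Span-scale vs k sx

  Span-∈ : ∀ {vs v} → v ∈ vs → Span vs v
  Span-∈ {v ∷ vs} (here ≡.refl) =
    + 1 , 0# , solve 1 (λ v → v := lit 1 :* v :+ lit 0) refl v , Span-0 vs
  Span-∈ {w ∷ vs} {v} (there v∈vs) =
    + 0 , v , solve 2 (λ v w → v := lit 0 :* w :+ v) refl v w , Span-∈ v∈vs

  Span-map : ∀ a vs ws → (∀ {v} → v ∈ vs → Span ws (a * v)) →
    ∀ {x} → Span vs x → Span ws (a * x)
  Span-map a []       ws f x≈0 = Span-resp ws (sym (trans (*-congˡ x≈0) (zeroʳ a))) (Span-0 ws)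
  Span-map a (v ∷ vs) ws f {x} (c , x′ , eq , sx′) = Span-resp ws
    (sym (trans (*-congˡ eq)
      (solve 4 (λ a c v x → a :* (c :* v :+ x) := c :* (a :* v) :+ a :* x) refl a (fromℤ c) v x′)))
    (Span-+ ws (Span-scale ws c (f (here ≡.refl))) (Span-map a vs ws (f ∘ there) sx′))

  oddℤ : ℤ → ℤ
  oddℤ k = + 1 ℤ.+ + 2 ℤ.* k

  fromℤ-odd : ∀ k → fromℤ (oddℤ k) ≈ 1# + 2# * fromℤ k
  fromℤ-odd k = trans (fromℤ-+ (+ 1) (+ 2 ℤ.* k)) (+-congˡ (fromℤ-* (+ 2) k))

  Span-of-zeros : ∀ {vs} → All (_≈ 0#) vs → ∀ {x} → Span vs x → x ≈ 0#
  Span-of-zeros []         x≈0               = x≈0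
  Span-of-zeros (v≈0 ∷ vs≈0) (c , x′ , eq , sx′) = trans eq (trans
    (+-cong (trans (*-congˡ v≈0) (zeroʳ _)) (Span-of-zeros vs≈0 sx′)) (+-identityˡ 0#))

  odd≢0 : ∀ k → oddℤ k ≢ + 0
  odd≢0 i e = 1≢2* ℤ.∣ i ∣ (≡.trans
    (≡.cong ℤ.∣_∣ (+-cancelˡ (+ 1) (ℤ.- + 1) (+ 2 ℤ.* i) (≡.sym e)))
    (ℤ.abs-* (+ 2) i))
    where
    open Algebra.Properties.Ring ℤ.+-*-ring using (+-cancelˡ)
    1≢2* : ∀ k → 1 ≢ 2 ℕ.* k
    1≢2* (suc k) e
      with () ← ≡.trans (ℕ.suc-injective e) (ℕ.+-suc k (k ℕ.+ 0))

  -- Membership of `v` in twice the span, localised at the odd integers; the odd multiplier clears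
  -- the denominator.
  Halved : List Carrier → Carrier → Set
  Halved vs v = ∃[ k ] ∃[ s ] fromℤ (oddℤ k) * v ≈ 2# * s × Span vs s

  -- Nakayama's lemma for ℤ localised at 2, by Gaussian elimination.
  nakayama : 1# ≉ 0# → ∀ vs → All (Halved vs) vs → All (_≈ 0#) vs
  nakayama 1≉0 []       []                                   = []
  nakayama 1≉0 (v ∷ vs) ((k , s , kv≈2s , c , s₀ , s≈ , ss₀) ∷ hs) = v≈0 ∷ vs≈0
    where
    -- With s = cv + s₀, moving 2cv to the left turns the multiplier 1 + 2k into 1 + 2(k - c), again
    -- odd. This is the pivot relation for `v`.
    l = k ℤ.- c
    lv≈2s₀ : fromℤ (oddℤ l) * v ≈ 2# * s₀
    lv≈2s₀ = combine₃
      (solve 6 (λ v s s₀ c k l → l :* v :- lit 2 :* s₀ :=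
         v :* (l :- (lit 1 :+ lit 2 :* (k :- c))) :+
         lit 1 :* ((lit 1 :+ lit 2 :* k) :* v :- lit 2 :* s) :+
         lit 2 :* (s :- (c :* v :+ s₀)))
         refl v s s₀ (fromℤ c) (fromℤ k) (fromℤ (oddℤ l)))
      (trans (fromℤ-odd l) (+-congˡ (*-congˡ (trans (fromℤ-+ k (ℤ.- c)) (+-congˡ (fromℤ-neg c))))))
      (trans (*-congʳ (sym (fromℤ-odd k))) kv≈2s)
      s≈

    -- Multiplying the relation for `w` by the odd pivot multiplier allows its multiple of `v` to be
    -- traded for one of s₀. The new multiplier is (1 + 2l)(1 + 2k′).
    eliminate : ∀ {w} → Halved (v ∷ vs) w → Halved vs w
    eliminate {w} (k′ , s′ , kw≈2s′ , c′ , s₁ , s′≈ , ss₁) =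
      l ℤ.+ k′ ℤ.+ + 2 ℤ.* (l ℤ.* k′) , fromℤ (+ 2 ℤ.* c′) * s₀ + fromℤ (oddℤ l) * s₁ ,
      trans (*-congʳ odd-product) (combine₃
        (solve 9 (λ v w s′ s₀ s₁ c′ k l c″ → l :* k :* w :- lit 2 :* (c″ :* s₀ :+ l :* s₁) :=
          l :* (k :* w :- lit 2 :* s′) :+ (lit 2 :* c′) :* (l :* v :- lit 2 :* s₀) :+
          lit 1 :* ((lit 2 :* l :* s′ :- lit 2 :* s₀ :* c″) :-
            (lit 2 :* l :* (c′ :* v :+ s₁) :- lit 2 :* s₀ :* (lit 2 :* c′))))
          refl v w s′ s₀ s₁ (fromℤ c′) (fromℤ (oddℤ k′)) (fromℤ (oddℤ l)) (fromℤ (+ 2 ℤ.* c′)))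
        kw≈2s′ lv≈2s₀
        (+-cong (*-congˡ s′≈) (-‿cong (*-congˡ (fromℤ-* (+ 2) c′))))) ,
      Span-+ vs (Span-scale vs (+ 2 ℤ.* c′) ss₀) (Span-scale vs (oddℤ l) ss₁)
      where
      odd-product : fromℤ (oddℤ (l ℤ.+ k′ ℤ.+ + 2 ℤ.* (l ℤ.* k′))) ≈
        fromℤ (oddℤ l) * fromℤ (oddℤ k′)
      odd-product = trans (reflexive (≡.cong fromℤ (ℤS.solve 2 (λ l k →
          ℤS.con (+ 1) ⊞ ℤS.con (+ 2) ⊠ (l ⊞ k ⊞ ℤS.con (+ 2) ⊠ (l ⊠ k)) ℤS.:=
          (ℤS.con (+ 1) ⊞ ℤS.con (+ 2) ⊠ l) ⊠ (ℤS.con (+ 1) ⊞ ℤS.con (+ 2) ⊠ k))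
          ≡.refl l k′)))
        (fromℤ-* (oddℤ l) (oddℤ k′))
        where
        module ℤS = Data.Integer.Solver.+-*-Solver
        open ℤS using () renaming (_:+_ to _⊞_; _:*_ to _⊠_)

    vs≈0 = nakayama 1≉0 vs (All.map eliminate hs)

    -- Once the other generators vanish so does s₀, and the odd integer before `v` is invertible in
    -- characteristic zero.
    v≈0 : v ≈ 0#
    v≈0 = invertible⇒cancelˡ (proj₂ (≉0⇒invertible (fromℤ-≉0 1≉0 (odd≢0 l))))
      (trans lv≈2s₀ (trans (trans (*-congˡ (Span-of-zeros vs≈0 ss₀)) (zeroʳ _)) (sym (zeroʳ _))))

-- The localisation of ℤ[t] at 1 + 2ℤ[t], and its units.

module TwoIntegral (Q̄ : AlgebraicClosureOfℚ) (t : AlgebraicClosureOfℚ.Carrier Q̄)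
  (root : IsRootOfUnity Q̄ t)
  (t≉1 : AlgebraicClosureOfℚ._≉_ Q̄ t (AlgebraicClosureOfℚ.1# Q̄))
  where
  open AlgebraicClosureOfℚ Q̄
  open Field Q̄ public
  open Relation.Binary.Reasoning.Setoid setoid

  -- In the trivial ring all elements agree, which `t≉1` rules out.
  1≉0 : 1# ≉ 0#
  1≉0 1≈0 = t≉1 (begin
    t       ≈⟨ *-identityʳ t ⟨
    t * 1#  ≈⟨ *-congˡ 1≈0 ⟩
    t * 0#  ≈⟨ zeroʳ t ⟩
    0#      ≈⟨ 1≈0 ⟨
    1#      ∎)

  -- Negatives come from the constant -1. Closure under `_≈_` is left to `Integral`, which carries
  -- an equation.
  data ℤ[t] : Carrier → Set where
    constant  : ∀ i → ℤ[t] (fromℤ i)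
    generator : ℤ[t] t
    plus      : ∀ {x y} → ℤ[t] x → ℤ[t] y → ℤ[t] (x + y)
    times     : ∀ {x y} → ℤ[t] x → ℤ[t] y → ℤ[t] (x * y)

  ℤ[t]-^ : ∀ n → ℤ[t] (t ^ n)
  ℤ[t]-^ zero    = constant (+ 1)
  ℤ[t]-^ (suc n) = times generator (ℤ[t]-^ n)

  powers : List Carrier
  powers = applyUpTo (t ^_) (proj₁ root)

  1∈powers : 1# ∈ powers
  1∈powers = ∈-applyUpTo⁺ (t ^_) (proj₁ (proj₂ root))

  -- Finiteness of ℤ[t] over ℤ: multiplication by `t` shifts the listed powers, and tⁿ = 1 brings
  -- the last back to the first.
  Span-powers-* : ∀ {a} → ℤ[t] a → ∀ {x} → Span powers x → Span powers (a * x)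
  Span-powers-* (constant i) sx = Span-scale powers i sx
  Span-powers-* generator    sx = Span-map t powers powers shift sx
    where
    shift : ∀ {v} → v ∈ powers → Span powers (t * v)
    shift v∈powers with i , i<n , ≡.refl ← ∈-applyUpTo⁻ (t ^_) v∈powers
      with ℕ.m≤n⇒m<n∨m≡n i<n
    ... | inj₁ 1+i<n  = Span-∈ (∈-applyUpTo⁺ (t ^_) 1+i<n)
    ... | inj₂ ≡.refl = Span-resp powers (sym (proj₂ (proj₂ root))) (Span-∈ 1∈powers)
  Span-powers-* (plus p q)   sx = Span-resp powers (sym (distribʳ _ _ _))
    (Span-+ powers (Span-powers-* p sx) (Span-powers-* q sx))
  Span-powers-* (times p q)  sx = Span-resp powers (sym (*-assoc _ _ _))
    (Span-powers-* p (Span-powers-* q sx))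

  -- If 1 + 2a = 0 then every power satisfies v = 2(-av), so the module of powers is twice itself;
  -- Nakayama's lemma then kills 1.
  1+2ℤ[t]≉0 : ∀ {a} → ℤ[t] a → 1# + 2# * a ≉ 0#
  1+2ℤ[t]≉0 {a} pa 1+2a≈0 = 1≉0 (All.lookup (nakayama 1≉0 powers (All.tabulate halved)) 1∈powers)
    where
    halved : ∀ {v} → v ∈ powers → Halved powers v
    halved {v} v∈powers = + 0 , fromℤ (ℤ.- + 1) * a * v ,
      combine₁ (solve 2 (λ a v → lit 1 :* v :- lit 2 :* (con (ℤ.- + 1) :* a :* v) :=
        v :* (lit 1 :+ lit 2 :* a :- lit 0)) refl a v) 1+2a≈0 ,
      Span-powers-* (times (constant (ℤ.- + 1)) pa) (Span-∈ v∈powers)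

  -- Membership of the localisation of ℤ[t] at 1 + 2ℤ[t].
  Integral : Carrier → Set
  Integral x = ∃[ a ] ∃[ b ] ℤ[t] a × ℤ[t] b × (1# + 2# * b) * x ≈ a

  ℤ[t]⇒integral : ∀ {a} → ℤ[t] a → Integral a
  ℤ[t]⇒integral {a} pa = a , fromℤ (+ 0) , pa , constant (+ 0) ,
    solve 1 (λ a → (lit 1 :+ lit 2 :* lit 0) :* a := a) refl a

  integral-# : ∀ i → Integral (fromℤ i)
  integral-# i = ℤ[t]⇒integral (constant i)

  integral-t : Integral t
  integral-t = ℤ[t]⇒integral generator

  infixl 6 _⊕_
  infixl 7 _⊛_

  _⊕_ : ∀ {x y} → Integral x → Integral y → Integral (x + y)
  _⊕_ {x} {y} (a , b , pa , pb , eq) (a′ , b′ , pa′ , pb′ , eq′) =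
    a * (1# + 2# * b′) + a′ * (1# + 2# * b) , b + b′ + 2# * (b * b′) ,
    plus (times pa (plus (constant (+ 1)) (times (constant (+ 2)) pb′)))
         (times pa′ (plus (constant (+ 1)) (times (constant (+ 2)) pb))) ,
    plus (plus pb pb′) (times (constant (+ 2)) (times pb pb′)) ,
    combine₂ (solve 6 (λ a b x a′ b′ y →
      (lit 1 :+ lit 2 :* (b :+ b′ :+ lit 2 :* (b :* b′))) :* (x :+ y)
        :- (a :* (lit 1 :+ lit 2 :* b′) :+ a′ :* (lit 1 :+ lit 2 :* b)) :=
      (lit 1 :+ lit 2 :* b′) :* ((lit 1 :+ lit 2 :* b) :* x :- a) :+
      (lit 1 :+ lit 2 :* b) :* ((lit 1 :+ lit 2 :* b′) :* y :- a′))
      refl a b x a′ b′ y) eq eq′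

  _⊛_ : ∀ {x y} → Integral x → Integral y → Integral (x * y)
  _⊛_ {x} {y} (a , b , pa , pb , eq) (a′ , b′ , pa′ , pb′ , eq′) =
    a * a′ , b + b′ + 2# * (b * b′) ,
    times pa pa′ , plus (plus pb pb′) (times (constant (+ 2)) (times pb pb′)) ,
    trans (solve 4 (λ b x b′ y →
      (lit 1 :+ lit 2 :* (b :+ b′ :+ lit 2 :* (b :* b′))) :* (x :* y) :=
      ((lit 1 :+ lit 2 :* b) :* x) :* ((lit 1 :+ lit 2 :* b′) :* y))
      refl b x b′ y) (*-cong eq eq′)

  integral-resp : ∀ {x y} → x ≈ y → Integral x → Integral y
  integral-resp x≈y (a , b , pa , pb , eq) = a , b , pa , pb , trans (*-congˡ (sym x≈y)) eq

  ⊝_ : ∀ {x} → Integral x → Integral (- x)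
  ⊝_ {x} ix = integral-resp (solve 1 (λ x → con (ℤ.- + 1) :* x := :- x) refl x)
    (integral-# (ℤ.- + 1) ⊛ ix)

  -- For x = a/(1 + 2b), clearing the denominator of 1 + 2x gives 1 + 2(a + b).
  1+2integral≉0 : ∀ {x} → Integral x → 1# + 2# * x ≉ 0#
  1+2integral≉0 {x} (a , b , pa , pb , eq) 1+2x≈0 = 1+2ℤ[t]≉0 (plus pa pb) (combine₂
    (solve 3 (λ x a b → lit 1 :+ lit 2 :* (a :+ b) :- lit 0 :=
      (lit 1 :+ lit 2 :* b) :* (lit 1 :+ lit 2 :* x :- lit 0) :+
      (:- lit 2) :* ((lit 1 :+ lit 2 :* b) :* x :- a)) refl x a b)
    1+2x≈0 eq)

  Unit : Carrier → Set
  Unit x = Integral x × ∃[ y ] Integral y × y * x ≈ 1#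

  unit-t : Unit t
  unit-t = invert root
    where
    invert : IsRootOfUnity Q̄ t → Unit t
    invert (suc n , _ , t*tⁿ≈1) =
      -- The exponent of the root of unity is `suc n`, so this power inverts `t`.
      integral-t , t ^ n , ℤ[t]⇒integral (ℤ[t]-^ n) , trans (*-comm _ _) t*tⁿ≈1

  unit-* : ∀ {x y} → Unit x → Unit y → Unit (x * y)
  unit-* {x} {y} (ix , k , ik , kx≈1) (iy , l , il , ly≈1) = ix ⊛ iy , k * l , ik ⊛ il ,
    combine₂ (solve 4 (λ x k y l → k :* l :* (x :* y) :- lit 1 :=
      l :* y :* (k :* x :- lit 1) :+ lit 1 :* (l :* y :- lit 1)) refl x k y l)
      kx≈1 ly≈1

  -- That is, 2 lies in the Jacobson radical: for x = a/(1 + 2b) the inverse is (1 + 2b)/(1 + 2(b +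
  -- a)).
  unit-1+2 : ∀ {x} → Integral x → Unit (1# + 2# * x)
  unit-1+2 {x} ix@(a , b , pa , pb , eq) = invert (≉0⇒invertible (1+2integral≉0 ix))
    where
    invert : ∃[ k ] k * (1# + 2# * x) ≈ 1# → Unit (1# + 2# * x)
    invert (k , k[1+2x]≈1) = integral-# (+ 1) ⊕ integral-# (+ 2) ⊛ ix , k ,
      (1# + 2# * b , b + a ,
       plus (constant (+ 1)) (times (constant (+ 2)) pb) , plus pb pa ,
       combine₂ (solve 4 (λ x a b k →
         (lit 1 :+ lit 2 :* (b :+ a)) :* k :- (lit 1 :+ lit 2 :* b) :=
         (lit 1 :+ lit 2 :* b) :* (k :* (lit 1 :+ lit 2 :* x) :- lit 1) :+
         (:- (lit 2 :* k)) :* ((lit 1 :+ lit 2 :* b) :* x :- a)) refl x a b k)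
         k[1+2x]≈1 eq) ,
      k[1+2x]≈1

  unit-resp : ∀ {x y} → x ≈ y → Unit x → Unit y
  unit-resp x≈y (ix , k , ik , kx≈1) =
    integral-resp x≈y ix , k , ik , trans (*-congˡ (sym x≈y)) kx≈1

  -- With k inverse to x, the sum factors as x(1 + 2ky).
  unit-+2 : ∀ {x y} → Unit x → Integral y → Unit (x + 2# * y)
  unit-+2 {x} {y} ux@(ix , k , ik , kx≈1) iy = unit-resp
    (combine₁ (solve 3 (λ x k y →
      x :* (lit 1 :+ lit 2 :* (k :* y)) :- (x :+ lit 2 :* y) :=
      lit 2 :* y :* (k :* x :- lit 1)) refl x k y) kx≈1)
    (unit-* ux (unit-1+2 (ik ⊛ iy)))

  unit≉0 : ∀ {x} → Unit x → x ≉ 0#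
  unit≉0 (_ , k , _ , kx≈1) x≈0 = 1≉0 (trans (sym kx≈1) (trans (*-congˡ x≈0) (zeroʳ k)))

  2≉0 : 2# ≉ 0#
  2≉0 = fromℤ-≉0 1≉0 {+ 2} (λ ())

  unit-2-t : Unit (2# - t)
  unit-2-t = unit-resp (solve 1 (λ t → t :+ lit 2 :* (lit 1 :- t) := lit 2 :- t) refl t)
    (unit-+2 unit-t (integral-# (+ 1) ⊕ ⊝ integral-t))

-- The addition law in terms of collinear points.

module Chords (Q̄ : AlgebraicClosureOfℚ) (t : AlgebraicClosureOfℚ.Carrier Q̄) where
  open AlgebraicClosureOfℚ Q̄
  open Field Q̄
  open Legendre Q̄ t
  open Algebra.Properties.Ring ring using (-‿involutive)

  cubic⟨_⟩ cubic′⟨_⟩ : ∀ {n} → Polynomial n → Polynomial n → Polynomial n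
  cubic⟨ t ⟩ x = x :* (x :- lit 1) :* (x :- t)
  cubic′⟨ t ⟩ x = (x :- lit 1) :* (x :- t) :+ x :* (x :- t) :+ x :* (x :- lit 1)

  cubic′-cong : ∀ {x y} → x ≈ y → cubic′ x ≈ cubic′ y
  cubic′-cong x≈y = +-cong (+-cong
    (*-cong (+-congʳ x≈y) (+-congʳ x≈y)) (*-cong x≈y (+-congʳ x≈y))) (*-cong x≈y (+-congʳ x≈y))

  sub-cong : ∀ {x x′ y y′} → x ≈ x′ → y ≈ y′ → x - y ≈ x′ - y′
  sub-cong x≈x′ y≈y′ = +-cong x≈x′ (-‿cong y≈y′)

  -- The line of slope m through (x₁ , y₁) meets the curve in the three
  -- given points; `tangency` compares derivatives at x₁, and makes the
  -- description meaningful for x₁ ≈ x₂ too.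
  record Line (x₁ y₁ x₂ y₂ x₃ y₃ : Carrier) : Set where
    field
      m         : Carrier
      abscissae : x₁ + x₂ + x₃ ≈ m * m + (1# + t)
      ordinate₂ : y₂ ≈ y₁ + m * (x₂ - x₁)
      ordinate₃ : y₃ ≈ y₁ + m * (x₃ - x₁)
      tangency  : cubic′ x₁ - m * (y₁ + y₁) ≈ (x₁ - x₂) * (x₁ - x₃)

  Line-resp : ∀ {x₁ y₁ x₂ y₂ x₃ y₃ x₁′ y₁′ x₂′ y₂′ x₃′ y₃′} →
    x₁ ≈ x₁′ → y₁ ≈ y₁′ → x₂ ≈ x₂′ → y₂ ≈ y₂′ → x₃ ≈ x₃′ → y₃ ≈ y₃′ →
    Line x₁ y₁ x₂ y₂ x₃ y₃ → Line x₁′ y₁′ x₂′ y₂′ x₃′ y₃′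
  Line-resp x₁≈ y₁≈ x₂≈ y₂≈ x₃≈ y₃≈ L = record
    { m         = m
    ; abscissae = trans (sym (+-cong (+-cong x₁≈ x₂≈) x₃≈)) abscissae
    ; ordinate₂ = trans (sym y₂≈) (trans ordinate₂ (+-cong y₁≈ (*-congˡ (sub-cong x₂≈ x₁≈))))
    ; ordinate₃ = trans (sym y₃≈) (trans ordinate₃ (+-cong y₁≈ (*-congˡ (sub-cong x₃≈ x₁≈))))
    ; tangency  = trans (sym (sub-cong (cubic′-cong x₁≈) (*-congˡ (+-cong y₁≈ y₁≈))))
        (trans tangency (*-cong (sub-cong x₁≈ x₂≈) (sub-cong x₁≈ x₃≈)))
    }
    where open Line L

  infix 8 -ₚ_
  -ₚ_ : Point → Point
  -ₚ O            = O
  -ₚ affine x y e = affine x (- y)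
    (trans (solve 1 (λ y → (:- y) :* (:- y) := y :* y) refl y) e)

  ≈ₚ-sym : ∀ {A B} → A ≈ₚ B → B ≈ₚ A
  ≈ₚ-sym O≈O             = O≈O
  ≈ₚ-sym (affine≈ x≈ y≈) = affine≈ (sym x≈) (sym y≈)

  ≈ₚ-refl : ∀ A → A ≈ₚ A
  ≈ₚ-refl O              = O≈O
  ≈ₚ-refl (affine _ _ _) = affine≈ refl refl

  -- Encodes P + A + B = O for the affine point P = (x₁ , y₁). A line through P meets `O` at most
  -- once, hence no constructor with both points at `O`.
  data Collinear (x₁ y₁ : Carrier) : Point → Point → Set where
    verticalˡ : ∀ {x y e} → x ≈ x₁ → y ≈ - y₁ → Collinear x₁ y₁ (affine x y e) O
    verticalʳ : ∀ {x y e} → x ≈ x₁ → y ≈ - y₁ → Collinear x₁ y₁ O (affine x y e)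
    line      : ∀ {x₂ y₂ e₂ x₃ y₃ e₃} → Line x₁ y₁ x₂ y₂ x₃ y₃ →
                Collinear x₁ y₁ (affine x₂ y₂ e₂) (affine x₃ y₃ e₃)

  Collinear-resp : ∀ {x₁ y₁ x₁′ A B B′} → x₁ ≈ x₁′ → B ≈ₚ B′ →
    Collinear x₁ y₁ A B → Collinear x₁′ y₁ A B′
  Collinear-resp x₁≈ O≈O               (verticalˡ x≈ y≈) = verticalˡ (trans x≈ x₁≈) y≈
  Collinear-resp x₁≈ (affine≈ x≈x′ y≈y′) (verticalʳ x≈ y≈) =
    verticalʳ (trans (sym x≈x′) (trans x≈ x₁≈)) (trans (sym y≈y′) y≈)
  Collinear-resp x₁≈ (affine≈ x≈x′ y≈y′) (line L) =
    line (Line-resp x₁≈ refl refl refl x≈x′ y≈y′ L)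

  module _ {x₁ y₁ : Carrier} (e₁ : OnCurve x₁ y₁) where
    private
      P = affine x₁ y₁ e₁

    sum-abscissae : ∀ m x₂ → x₁ + x₂ + sumX m x₁ x₂ ≈ m * m + (1# + t)
    sum-abscissae m x₂ = solve 4 (λ t m x₁ x₂ →
      x₁ :+ x₂ :+ (m :* m :+ (lit 1 :+ t) :- x₁ :- x₂) := m :* m :+ (lit 1 :+ t))
      refl t m x₁ x₂

    -- Chord, tangent and vertical line are brought to one form here, so that later computations
    -- need not separate them.
    collinear-sum : ∀ A → Collinear x₁ y₁ A (-ₚ (P +ₚ A))
    collinear-sum O                = verticalʳ refl refl
    collinear-sum (affine x₂ y₂ e₂) with x₁ #? x₂
    ... | yes x₁#x₂ =
      let k , kd≈1 , _ = #⇒invertible x₁#x₂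
          m            = (y₁ - y₂) * k
          md≈          = cancel {y₁ - y₂} kd≈1
          ordinate₂    = combine₁ (solve 5 (λ m x₁ y₁ x₂ y₂ →
            y₂ :- (y₁ :+ m :* (x₂ :- x₁)) := lit 1 :* (m :* (x₁ :- x₂) :- (y₁ :- y₂)))
            refl m x₁ y₁ x₂ y₂) md≈
      in line record
        { m         = m
        ; abscissae = sum-abscissae m x₂
        ; ordinate₂ = ordinate₂
        ; ordinate₃ = -‿involutive _
        -- The cubic minus the square of the line is (x - x₁)(x - x₂)(x - X), and `tangency` is its
        -- derivative at x₁. Multiplying by x₁ - x₂ lets both curve equations be used.
        ; tangency  = invertible⇒cancelˡ kd≈1 (combine₃ (solve 6 (λ t m x₁ y₁ x₂ y₂ →
            let X = m :* m :+ (lit 1 :+ t) :- x₁ :- x₂ in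
            (x₁ :- x₂) :* (cubic′⟨ t ⟩ x₁ :- m :* (y₁ :+ y₁)) :-
              (x₁ :- x₂) :* ((x₁ :- x₂) :* (x₁ :- X)) :=
            (:- lit 1) :* (y₁ :* y₁ :- cubic⟨ t ⟩ x₁) :+ lit 1 :* (y₂ :* y₂ :- cubic⟨ t ⟩ x₂) :+
            (:- (y₂ :+ (y₁ :+ m :* (x₂ :- x₁)))) :* (y₂ :- (y₁ :+ m :* (x₂ :- x₁))))
            refl t m x₁ y₁ x₂ y₂) e₁ e₂ ordinate₂)
        }
    ... | no ¬x₁#x₂ with y₁ #? - y₂
    ...   | no ¬y₁#-y₂ = verticalˡ (sym (proj₁ (tight _ _) ¬x₁#x₂))
      (trans (sym (-‿involutive y₂)) (-‿cong (sym (proj₁ (tight _ _) ¬y₁#-y₂))))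
    ...   | yes y₁#-y₂ =
      let k , ks≈1 , _ = #⇒invertible y₁#-y₂
          m            = cubic′ x₁ * k
          X            = sumX m x₁ x₁
          x₁≈x₂        = proj₁ (tight x₁ x₂) ¬x₁#x₂
          y₁≈y₂        = same-ordinate e₁ e₂ x₁≈x₂ ks≈1
          ms≈          = trans (*-congˡ (+-congˡ (trans y₁≈y₂ (sym (-‿involutive y₂)))))
                           (cancel {cubic′ x₁} ks≈1)
      in line record
        { m         = m
        ; abscissae = trans (+-congʳ (+-congˡ (sym x₁≈x₂))) (sum-abscissae m x₁)
        ; ordinate₂ = combine₂ (solve 5 (λ m x₁ y₁ x₂ y₂ →
            y₂ :- (y₁ :+ m :* (x₂ :- x₁)) := (:- lit 1) :* (y₁ :- y₂) :+ m :* (x₁ :- x₂))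
            refl m x₁ y₁ x₂ y₂) y₁≈y₂ x₁≈x₂
        ; ordinate₃ = -‿involutive _
        ; tangency  = combine₂ (solve 6 (λ m x₁ y₁ x₂ c X →
            c :- m :* (y₁ :+ y₁) :- (x₁ :- x₂) :* (x₁ :- X) :=
            (:- lit 1) :* (m :* (y₁ :+ y₁) :- c) :+ (:- (x₁ :- X)) :* (x₁ :- x₂))
            refl m x₁ y₁ x₂ (cubic′ x₁) X) ms≈ x₁≈x₂
        }

    -- By Vieta: once the slope of the addition law is known to be that of the line, `abscissae`
    -- forces the third point.
    third-point : ∀ {x₂ y₂ x₃ y₃ x m′} (L : Line x₁ y₁ x₂ y₂ x₃ y₃) →
      x ≈ x₃ → m′ ≈ Line.m L → ∀ {e e₂} →
      affine (sumX m′ x₁ x) (sumY m′ x₁ y₁ x) e ≈ₚ affine x₂ (- y₂) e₂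
    third-point {x₂} {y₂} {x₃} {y₃} {x} {m′} L x≈x₃ m′≈m =
      affine≈ X≈x₂ (-‿cong (trans (+-congˡ (*-cong m′≈m (+-congʳ X≈x₂))) (sym ordinate₂)))
      where
      open Line L
      X≈x₂ : sumX m′ x₁ x ≈ x₂
      X≈x₂ = combine₃ (solve 7 (λ t m m′ x₁ x₂ x₃ x →
        m′ :* m′ :+ (lit 1 :+ t) :- x₁ :- x :- x₂ :=
        (m :+ m′) :* (m′ :- m) :+ (:- lit 1) :* (x₁ :+ x₂ :+ x₃ :- (m :* m :+ (lit 1 :+ t))) :+
        (:- lit 1) :* (x :- x₃)) refl t m m′ x₁ x₂ x₃ x) m′≈m abscissae x≈x₃

    -- Converse of `collinear-sum` with the two points exchanged. A non-vertical line through P and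
    -- -P would give 2y₁ = 0, hence the first two hypotheses.
    sum-collinear : y₁ ≉ 0# → 2# ≉ 0# → ∀ {A B} → Collinear x₁ y₁ A B → P +ₚ B ≈ₚ -ₚ A
    sum-collinear _ _ (verticalˡ x≈ y≈) =
      affine≈ (sym x≈) (trans (sym (-‿involutive y₁)) (-‿cong (sym y≈)))
    sum-collinear _ _ (verticalʳ {x} {y} x≈ y≈) with x₁ #? x
    ... | yes x₁#x = contradiction x₁#x (proj₂ (tight _ _) (sym x≈))
    ... | no _ with y₁ #? - y
    ...   | yes y₁#-y = contradiction y₁#-y
      (proj₂ (tight _ _) (trans (sym (-‿involutive y₁)) (-‿cong (sym y≈))))
    ...   | no _ = O≈O
    sum-collinear y₁≉0 2≉0 (line {x₂} {y₂} {_} {x₃} {y₃} {e₃} L) with x₁ #? x₃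
    ... | yes x₁#x₃ = let k , kd≈1 , _ = #⇒invertible x₁#x₃ in
      third-point L refl (invertible⇒cancelˡ kd≈1 (slope {k} kd≈1))
      where
      open Line L
      slope : ∀ {k} → k * (x₁ - x₃) ≈ 1# → (x₁ - x₃) * ((y₁ - y₃) * k) ≈ (x₁ - x₃) * m
      slope {k} kd≈1 = combine₂ (solve 6 (λ m x₁ y₁ x₃ y₃ k →
        (x₁ :- x₃) :* ((y₁ :- y₃) :* k) :- (x₁ :- x₃) :* m :=
        (y₁ :- y₃) :* (k :* (x₁ :- x₃) :- lit 1) :+
        (:- lit 1) :* (y₃ :- (y₁ :+ m :* (x₃ :- x₁)))) refl m x₁ y₁ x₃ y₃ k) kd≈1 ordinate₃
    ... | no ¬x₁#x₃ with y₁ #? - y₃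
    ...   | no ¬y₁#-y₃ = contradiction 2y₁≈0 (*-≉0 2≉0 y₁≉0)
      where
      open Line L
      2y₁≈0 : 2# * y₁ ≈ 0#
      2y₁≈0 = combine₃ (solve 5 (λ m x₁ y₁ x₃ y₃ → lit 2 :* y₁ :- lit 0 :=
        lit 1 :* (y₁ :- (:- y₃)) :+ (:- lit 1) :* (y₃ :- (y₁ :+ m :* (x₃ :- x₁))) :+
        m :* (x₁ :- x₃)) refl m x₁ y₁ x₃ y₃)
        (proj₁ (tight _ _) ¬y₁#-y₃) ordinate₃ (proj₁ (tight _ _) ¬x₁#x₃)
    ...   | yes y₁#-y₃ = let k , ks≈1 , _ = #⇒invertible y₁#-y₃ in
      third-point L x₁≈x₃ (invertible⇒cancelˡ ks≈1 (slope {k} ks≈1))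
      where
      open Line L
      x₁≈x₃ = proj₁ (tight _ _) ¬x₁#x₃
      -- As x₃ = x₁, the right side of `tangency` vanishes, so `m` is the tangent slope.
      slope : ∀ {k} → k * (y₁ - - y₃) ≈ 1# →
        (y₁ - - y₃) * (cubic′ x₁ * k) ≈ (y₁ - - y₃) * m
      slope {k} ks≈1 = combine₃ (solve 9 (λ m x₁ y₁ x₂ y₂ x₃ y₃ k c →
        (y₁ :- :- y₃) :* (c :* k) :- (y₁ :- :- y₃) :* m :=
        c :* (k :* (y₁ :- :- y₃) :- lit 1) :+
        lit 1 :* (c :- m :* (y₁ :+ y₁) :- (x₁ :- x₂) :* (x₁ :- x₃)) :+
        lit 1 :* ((x₁ :- x₂) :* (x₁ :- x₃) :+ m :* y₁ :- ((x₁ :- x₂) :* (x₁ :- x₁) :+ m :* y₃)))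
        refl m x₁ y₁ x₂ y₂ x₃ y₃ k (cubic′ x₁)) ks≈1 tangency
        (+-cong (*-congˡ (sub-cong refl (sym x₁≈x₃)))
          (*-congˡ (same-ordinate e₁ e₃ x₁≈x₃ ks≈1)))

-- The 2-adic shape of even and odd multiples.

module Multiples (Q̄ : AlgebraicClosureOfℚ) (t : AlgebraicClosureOfℚ.Carrier Q̄)
  (root : IsRootOfUnity Q̄ t)
  (t≉1 : AlgebraicClosureOfℚ._≉_ Q̄ t (AlgebraicClosureOfℚ.1# Q̄))
  where
  open AlgebraicClosureOfℚ Q̄
  open Legendre Q̄ t
  open TwoIntegral Q̄ t root t≉1
  open Chords Q̄ t
  open Algebra.Properties.Ring ring using (-‿involutive)

  8# : Carrier
  8# = fromℤ (+ 8)

  -- Even multiples are near O, in the coordinates 1/x and x/y.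
  data Even (y₁ : Carrier) : Point → Set where
    O      : Even y₁ O
    affine : ∀ {x y e q ζ} → Integral q → Integral ζ →
             8# * q * x ≈ 1# → x ≈ 2# * y₁ * ζ * y → Even y₁ (affine x y e)

  -- Odd multiples stay near (2 , y₁). Ordinates are measured relative to `y₁`, of which only the
  -- square is known to lie in the ring.
  data Odd (y₁ : Carrier) : Point → Set where
    affine : ∀ {x y e u θ} → Integral u → Integral θ →
             x ≈ 2# + 8# * u → y ≈ y₁ * (1# + 2# * θ) → Odd y₁ (affine x y e)

  -- An even multiple therefore never has abscissa 2, which excludes a vertical line through P.
  8q2≉1 : ∀ {q} → Integral q → 8# * q * 2# ≉ 1#
  8q2≉1 {q} iq 16q≈1 = 1+2integral≉0 (integral-# (ℤ.- + 8) ⊛ iq) (combine₁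
    (solve 1 (λ q → lit 1 :+ lit 2 :* (con (ℤ.- + 8) :* q) :- lit 0 :=
      (:- lit 1) :* (lit 8 :* q :* lit 2 :- lit 1)) refl q) 16q≈1)

  module _ {y₁ : Carrier} (y₁²≈ : y₁ * y₁ ≈ 2# * (2# - t)) where

    -- With z = 2y₁ζ and κ = 1/x the equation of the curve is κ = z²e, and the
    -- slope is m = (1 - gκ)/zF.  Its pole at z = 0 cancels against that of x in
    -- X = m² + t - 1 - x.
    even⇒odd-line : ∀ {x y q ζ X Y} → OnCurve x y → Integral q → Integral ζ →
      8# * q * x ≈ 1# → x ≈ 2# * y₁ * ζ * y → Line 2# y₁ x y X Y →
      ∃[ u ] ∃[ θ ] Integral u × Integral θ × X ≈ 2# + 8# * u × - Y ≈ y₁ * (1# + 2# * θ)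
    even⇒odd-line {x} {y} {q} {ζ} {X} {Y} onCurve iq iζ κx≈1 x≈zy L =
      u , θ , iu , iθ , X≈ , -Y≈
      where
      open Line L
      -- Here y₁² = 2s, e = cubic(x)/x³, g = y₁z and F = (x - 2)/x, all written without the pole of
      -- x.
      s κ e g F : Carrier
      s = 2# - t
      κ = 8# * q
      e = (1# - κ) * (1# - t * κ)
      g = fromℤ (+ 4) * s * ζ
      F = 1# + 2# * - κ

      iκ : Integral κ
      iκ = integral-# (+ 8) ⊛ iq
      is : Integral s
      is = integral-# (+ 2) ⊕ ⊝ integral-t
      ie : Integral e
      ie = (integral-# (+ 1) ⊕ ⊝ iκ) ⊛ (integral-# (+ 1) ⊕ ⊝ (integral-t ⊛ iκ))
      ig : Integral g
      ig = integral-# (+ 4) ⊛ is ⊛ iζ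

      unit-F : Unit F
      unit-F = unit-1+2 (⊝ iκ)
      f : Carrier
      f = proj₁ (proj₂ unit-F)
      if : Integral f
      if = proj₁ (proj₂ (proj₂ unit-F))
      fF≈1 : f * F ≈ 1#
      fF≈1 = proj₂ (proj₂ (proj₂ unit-F))

      -- Since z² = 8sζ², x = zy turns the curve equation into x² = z² cubic(x); multiplication by
      -- κ³ gives κ = z²e.
      κ≈ : κ ≈ 8# * s * (ζ * ζ) * e
      κ≈ = combine₂ (solve 4 (λ t κ x c →
        let w = κ :* x in
        κ :- c :* ((lit 1 :- κ) :* (lit 1 :- t :* κ)) :=
        κ :* κ :* κ :* (x :* x :- c :* cubic⟨ t ⟩ x) :+
        (c :* (w :* w :+ w :+ lit 1 :- (lit 1 :+ t) :* κ :* (w :+ lit 1) :+ t :* (κ :* κ))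
          :- κ :* (w :+ lit 1)) :* (w :- lit 1)) refl t κ x (8# * s * (ζ * ζ)))
        x²≈ κx≈1
        where
        x²≈ : x * x ≈ 8# * s * (ζ * ζ) * cubic x
        x²≈ = combine₃ (solve 6 (λ s y₁ ζ x y C →
          let z = lit 2 :* y₁ :* ζ in
          x :* x :- lit 8 :* s :* (ζ :* ζ) :* C :=
          (x :+ z :* y) :* (x :- z :* y) :+ z :* z :* (y :* y :- C) :+
          lit 4 :* (ζ :* ζ) :* C :* (y₁ :* y₁ :- lit 2 :* s)) refl s y₁ ζ x y (cubic x))
          x≈zy onCurve y₁²≈

      -- The poles cancel in κF²(X - 2) = κ(κH - 2ge). Replacing the inner κ by 8sζ²e then makes the
      -- cofactor 8sζG.
      G H : Carrier
      H = (t - fromℤ (+ 3)) * (fromℤ (ℤ.- + 4) + fromℤ (+ 4) * κ) + t - fromℤ (+ 4) + g * g * e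
      G = e * (ζ * H - 1#)

      iG : Integral G
      iG = ie ⊛ (iζ ⊛ ((integral-t ⊕ ⊝ integral-# (+ 3)) ⊛
          (integral-# (ℤ.- + 4) ⊕ integral-# (+ 4) ⊛ iκ)
        ⊕ integral-t ⊕ ⊝ integral-# (+ 4) ⊕ ig ⊛ ig ⊛ ie) ⊕ ⊝ integral-# (+ 1))

      mzF≈ : m * (2# * y₁ * ζ) * F ≈ 1# - g * κ
      mzF≈ = combine₃ (solve 7 (λ s y₁ m κ x y ζ →
        let z = lit 2 :* y₁ :* ζ in
        m :* z :* (lit 1 :+ lit 2 :* (:- κ)) :- (lit 1 :- lit 4 :* s :* ζ :* κ) :=
        (:- (m :* z)) :* (κ :* x :- lit 1) :+
        lit 1 :* (κ :* (z :* (y₁ :+ m :* (x :- lit 2))) :- lit 1) :+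
        (:- (lit 2 :* ζ :* κ)) :* (y₁ :* y₁ :- lit 2 :* s)) refl s y₁ m κ x y ζ)
        κx≈1 (trans (*-congˡ (sym (trans x≈zy (*-congˡ ordinate₂)))) κx≈1) y₁²≈

      F²[X-2]≈ : F * F * (X - 2#) ≈ 8# * s * ζ * G
      F²[X-2]≈ = invertible⇒cancelˡ (trans (*-comm x κ) κx≈1) (trans
        (combine₃ (solve 8 (λ t m κ g e F x X →
          κ :* (F :* F :* (X :- lit 2)) :-
            (e :* ((lit 1 :- g :* κ) :* (lit 1 :- g :* κ)) :+
              (t :- lit 3) :* κ :* (F :* F) :- F :* F) :=
          κ :* (F :* F) :* (lit 2 :+ x :+ X :- (m :* m :+ (lit 1 :+ t))) :+
          (:- (F :* F)) :* (κ :* x :- lit 1) :+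
          lit 1 :* (κ :* (F :* F) :* (m :* m) :- e :* ((lit 1 :- g :* κ) :* (lit 1 :- g :* κ))))
          refl t m κ g e F x X)
          abscissae κx≈1 κF²m²≈)
        (combine₁ (solve 4 (λ t s κ ζ →
          let e = (lit 1 :- κ) :* (lit 1 :- t :* κ)
              g = lit 4 :* s :* ζ
              F = lit 1 :+ lit 2 :* (:- κ)
              H = (t :- lit 3) :* (con (ℤ.- + 4) :+ lit 4 :* κ) :+ t :- lit 4 :+ g :* g :* e
              G = e :* (ζ :* H :- lit 1)
          in
          e :* ((lit 1 :- g :* κ) :* (lit 1 :- g :* κ)) :+ (t :- lit 3) :* κ :* (F :* F) :- F :* F
            :- κ :* (lit 8 :* s :* ζ :* G) :=
          κ :* H :* (κ :- lit 8 :* s :* (ζ :* ζ) :* e)) refl t s κ ζ)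
          κ≈))
        where
        κF²m²≈ : κ * (F * F) * (m * m) ≈ e * ((1# - g * κ) * (1# - g * κ))
        κF²m²≈ = combine₃ (solve 8 (λ s y₁ m κ ζ e F k →
          let z = lit 2 :* y₁ :* ζ in
          κ :* (F :* F) :* (m :* m) :- e :* (k :* k) :=
          F :* F :* (m :* m) :* (κ :- lit 8 :* s :* (ζ :* ζ) :* e) :+
          (:- (lit 4 :* (ζ :* ζ) :* e :* (F :* F) :* (m :* m))) :* (y₁ :* y₁ :- lit 2 :* s) :+
          e :* (m :* z :* F :+ k) :* (m :* z :* F :- k)) refl s y₁ m κ ζ e F (1# - g * κ))
          κ≈ y₁²≈ mzF≈

      -- The ζ in `u` absorbs the pole of `m`, because 4sζm = y₁(mz). The -1 in `θ` comes from -y₁ =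
      -- y₁(1 - 2).
      u θ : Carrier
      u = s * ζ * G * (f * f)
      θ = - 1# - (1# - g * κ) * (f * f * f) * G

      iu : Integral u
      iu = is ⊛ iζ ⊛ iG ⊛ (if ⊛ if)
      iθ : Integral θ
      iθ = ⊝ integral-# (+ 1) ⊕ ⊝ ((integral-# (+ 1) ⊕ ⊝ (ig ⊛ iκ)) ⊛ (if ⊛ if ⊛ if) ⊛ iG)

      X≈ : X ≈ 2# + 8# * u
      X≈ = combine₂ (solve 6 (λ s ζ G f F X →
        X :- (lit 2 :+ lit 8 :* (s :* ζ :* G :* (f :* f))) :=
        f :* f :* (F :* F :* (X :- lit 2) :- lit 8 :* s :* ζ :* G) :+
        (:- ((X :- lit 2) :* (f :* F :+ lit 1))) :* (f :* F :- lit 1)) refl s ζ G f F X)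
        F²[X-2]≈ fF≈1

      -Y≈ : - Y ≈ y₁ * (1# + 2# * θ)
      -Y≈ = trans
        (combine₂ (solve 5 (λ y₁ m u X Y →
          :- Y :- (:- (y₁ :+ m :* (lit 8 :* u))) :=
          (:- lit 1) :* (Y :- (y₁ :+ m :* (X :- lit 2))) :+
          (:- m) :* (X :- (lit 2 :+ lit 8 :* u))) refl y₁ m u X Y)
          ordinate₃ X≈)
        (combine₂ (solve 7 (λ s y₁ m ζ G f k →
          :- (y₁ :+ m :* (lit 8 :* (s :* ζ :* G :* (f :* f)))) :-
            y₁ :* (lit 1 :+ lit 2 :* (:- lit 1 :- k :* (f :* f :* f) :* G)) :=
          lit 4 :* m :* ζ :* G :* (f :* f) :* (y₁ :* y₁ :- lit 2 :* s) :+
          (:- (lit 2 :* y₁ :* G :* (f :* f))) :* (m :* (lit 2 :* y₁ :* ζ) :- f :* k))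
          refl s y₁ m ζ G f (1# - g * κ))
          y₁²≈ mz≈)
        where
        mz≈ : m * (2# * y₁ * ζ) ≈ f * (1# - g * κ)
        mz≈ = combine₂ (solve 5 (λ m z f F k →
          m :* z :- f :* k := f :* (m :* z :* F :- k) :+ (:- (m :* z)) :* (f :* F :- lit 1))
          refl m (2# * y₁ * ζ) f F (1# - g * κ)) mzF≈ fF≈1

    -- The slope is A/(y₁ + y), where A is the divided difference of the cubic,
    -- and A is a unit at 2.  No division by x - 2 occurs, so that the tangent
    -- at (2 , y₁) is covered.
    odd⇒even-line : ∀ {u θ X Y} → Integral u → Integral θ →
      Line 2# y₁ (2# + 8# * u) (y₁ * (1# + 2# * θ)) X Y →
      ∃[ q ] ∃[ ζ ] Integral q × Integral ζ × 8# * q * X ≈ 1# × X ≈ 2# * y₁ * ζ * - Y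
    odd⇒even-line {u} {θ} {X} {Y} iu iθ L = q , ζ , iq , iζ , 8qX≈1 , X≈
      where
      open Line L
      -- For the second point (x , y), y₁ + y = 2y₁B and K = (y₁ + y)². `D` and `E` will be KX and
      -- (y₁ + y)KY; modulo 2, `A`, `D`, `E` are t, t², t³, hence units.
      s B A K D E d ε : Carrier
      s = 2# - t
      B = 1# + θ
      A = t + 2# * (fromℤ (+ 4) - 2# * t + fromℤ (+ 20) * u + fromℤ (+ 32) * (u * u)
        - fromℤ (+ 4) * (u * t))
      K = 8# * s * (B * B)
      D = A * A + 2# * (fromℤ (+ 4) * s * (B * B) * (t - fromℤ (+ 3) - 8# * u))
      E = A * D + 2# * (2# * s * B * K - A * K)

      is : Integral s
      is = integral-# (+ 2) ⊕ ⊝ integral-t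
      iB : Integral B
      iB = integral-# (+ 1) ⊕ iθ
      iK : Integral K
      iK = integral-# (+ 8) ⊛ is ⊛ (iB ⊛ iB)
      unit-A : Unit A
      unit-A = unit-+2 unit-t (integral-# (+ 4) ⊕ ⊝ (integral-# (+ 2) ⊛ integral-t)
        ⊕ integral-# (+ 20) ⊛ iu
        ⊕ integral-# (+ 32) ⊛ (iu ⊛ iu) ⊕ ⊝ (integral-# (+ 4) ⊛ (iu ⊛ integral-t)))
      unit-D : Unit D
      unit-D = unit-+2 (unit-* unit-A unit-A) (integral-# (+ 4) ⊛ is ⊛ (iB ⊛ iB)
        ⊛ (integral-t ⊕ ⊝ integral-# (+ 3) ⊕ ⊝ (integral-# (+ 8) ⊛ iu)))
      unit-E : Unit E
      unit-E = unit-+2 (unit-* unit-A unit-D)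
        (integral-# (+ 2) ⊛ is ⊛ iB ⊛ iK ⊕ ⊝ (proj₁ unit-A ⊛ iK))

      d = proj₁ (proj₂ unit-D)
      dD≈1 : d * D ≈ 1#
      dD≈1 = proj₂ (proj₂ (proj₂ unit-D))
      ε = proj₁ (proj₂ unit-E)
      εE≈1 : ε * E ≈ 1#
      εE≈1 = proj₂ (proj₂ (proj₂ unit-E))

      -- `tangency` at 2, corrected by 2 - x times `abscissae`, yields the slope for distinct and
      -- equal points alike.
      2my₁B≈A : m * (2# * y₁ * B) ≈ A
      2my₁B≈A = combine₃ (solve 6 (λ t m y₁ u θ X →
        let x = lit 2 :+ lit 8 :* u
            y = y₁ :* (lit 1 :+ lit 2 :* θ)
            A = t :+ lit 2 :* (lit 4 :- lit 2 :* t :+ lit 20 :* u :+ lit 32 :* (u :* u)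
                  :- lit 4 :* (u :* t))
        in
        m :* (lit 2 :* y₁ :* (lit 1 :+ θ)) :- A :=
        m :* (y :- (y₁ :+ m :* (x :- lit 2))) :+
        (:- lit 1) :* (cubic′⟨ t ⟩ (lit 2) :- m :* (y₁ :+ y₁) :- (lit 2 :- x) :* (lit 2 :- X)) :+
        (lit 2 :- x) :* (lit 2 :+ x :+ X :- (m :* m :+ (lit 1 :+ t))))
        refl t m y₁ u θ X)
        ordinate₂ tangency abscissae

      Km²≈A² : K * (m * m) ≈ A * A
      Km²≈A² = combine₂ (solve 5 (λ t m y₁ B A →
        lit 8 :* (lit 2 :- t) :* (B :* B) :* (m :* m) :- A :* A :=
        (:- (lit 4 :* (B :* B) :* (m :* m))) :* (y₁ :* y₁ :- lit 2 :* (lit 2 :- t)) :+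
        (m :* (lit 2 :* y₁ :* B) :+ A) :* (m :* (lit 2 :* y₁ :* B) :- A)) refl t m y₁ B A)
        y₁²≈ 2my₁B≈A

      KX≈D : K * X ≈ D
      KX≈D = combine₂ (solve 6 (λ t m u B A X →
        let s = lit 2 :- t
            K = lit 8 :* s :* (B :* B)
            D = A :* A :+ lit 2 :* (lit 4 :* s :* (B :* B) :* (t :- lit 3 :- lit 8 :* u))
        in
        K :* X :- D :=
        K :* (lit 2 :+ (lit 2 :+ lit 8 :* u) :+ X :- (m :* m :+ (lit 1 :+ t))) :+
        lit 1 :* (K :* (m :* m) :- A :* A)) refl t m u B A X)
        abscissae Km²≈A²

      2y₁BKY≈E : 2# * y₁ * B * K * Y ≈ E
      2y₁BKY≈E = combine₃ (solve 9 (λ t m y₁ B K A D X Y →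
        let s = lit 2 :- t in
        lit 2 :* y₁ :* B :* K :* Y :- (A :* D :+ lit 2 :* (lit 2 :* s :* B :* K :- A :* K)) :=
        (lit 2 :* y₁ :* B :* K) :* (Y :- (y₁ :+ m :* (X :- lit 2))) :+
        (lit 2 :* B :* K) :* (y₁ :* y₁ :- lit 2 :* s) :+
        lit 1 :* (K :* (X :- lit 2) :* (m :* (lit 2 :* y₁ :* B)) :- A :* (D :- lit 2 :* K)))
        refl t m y₁ B K A D X Y)
        ordinate₃ y₁²≈
        (trans (*-congˡ 2my₁B≈A) (trans (*-comm _ _) (*-congˡ (trans (distribˡ _ _ _)
          (+-cong KX≈D (solve 1 (λ K → K :* (:- lit 2) := :- (lit 2 :* K)) refl K))))))

      -- 8q is K/D = 1/X, and 2y₁ζ is -2y₁BD/E = X/(-Y).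
      q ζ : Carrier
      q = s * (B * B) * d
      ζ = - (B * D * ε)

      iq : Integral q
      iq = is ⊛ (iB ⊛ iB) ⊛ proj₁ (proj₂ (proj₂ unit-D))
      iζ : Integral ζ
      iζ = ⊝ (iB ⊛ proj₁ unit-D ⊛ proj₁ (proj₂ (proj₂ unit-E)))

      8qX≈1 : 8# * q * X ≈ 1#
      8qX≈1 = combine₂ (solve 5 (λ s B² d D X →
        lit 8 :* (s :* B² :* d) :* X :- lit 1 :=
        d :* (lit 8 :* s :* B² :* X :- D) :+ lit 1 :* (d :* D :- lit 1))
        refl s (B * B) d D X) KX≈D dD≈1

      X≈ : X ≈ 2# * y₁ * ζ * - Y
      X≈ = combine₃ (solve 8 (λ y₁ B D ε K E X Y →
        X :- lit 2 :* y₁ :* (:- (B :* D :* ε)) :* (:- Y) :=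
        (:- X) :* (ε :* E :- lit 1) :+ (:- (ε :* X)) :* (lit 2 :* y₁ :* B :* K :* Y :- E) :+
        (lit 2 :* y₁ :* B :* ε :* Y) :* (K :* X :- D)) refl y₁ B D ε K E X Y)
        εE≈1 2y₁BKY≈E KX≈D

    -- Only the last clause is a genuine chord. If C = O then A would have abscissa 2, and if A = O
    -- then C is P itself.
    even⇒odd : ∀ {A} C → Even y₁ A → Collinear 2# y₁ A (-ₚ C) → Odd y₁ C
    even⇒odd O O ()
    even⇒odd O (affine iq _ 8qx≈1 _) (verticalˡ x≈2 _) =
      contradiction (trans (*-congˡ (sym x≈2)) 8qx≈1) (8q2≉1 iq)
    even⇒odd (affine X Y _) O (verticalʳ X≈2 -Y≈-y₁) =
      affine (integral-# (+ 0)) (integral-# (+ 0))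
        (trans X≈2 (solve 0 (lit 2 := lit 2 :+ lit 8 :* lit 0) refl))
        (combine₁ (solve 2 (λ Y y₁ →
          Y :- y₁ :* (lit 1 :+ lit 2 :* lit 0) := (:- lit 1) :* ((:- Y) :- (:- y₁)))
          refl Y y₁) -Y≈-y₁)
    even⇒odd (affine X Y _) (affine {e = e} iq iζ 8qx≈1 x≈) (line L) =
      toOdd (even⇒odd-line e iq iζ 8qx≈1 x≈ L)
      where
      toOdd : ∃[ u ] ∃[ θ ] Integral u × Integral θ ×
        X ≈ 2# + 8# * u × - - Y ≈ y₁ * (1# + 2# * θ) → ∀ {e′} → Odd y₁ (affine X Y e′)
      toOdd (_ , _ , iu , iθ , X≈ , Y≈) = affine iu iθ X≈ (trans (sym (-‿involutive Y)) Y≈)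

    odd⇒even : ∀ {A} C → Odd y₁ A → Collinear 2# y₁ A (-ₚ C) → Even y₁ C
    odd⇒even O              _                      _        = O
    odd⇒even (affine X Y _) (affine iu iθ x≈ y≈) (line L) =
      toEven (odd⇒even-line iu iθ (Line-resp refl refl x≈ y≈ refl refl L))
      where
      toEven : ∃[ q ] ∃[ ζ ] Integral q × Integral ζ ×
        8# * q * X ≈ 1# × X ≈ 2# * y₁ * ζ * - - Y → ∀ {e′} → Even y₁ (affine X Y e′)
      toEven (_ , _ , iq , iζ , 8qX≈1 , X≈) =
        affine iq iζ 8qX≈1 (trans X≈ (*-congˡ (-‿involutive Y)))

  -- Descent on the order of P.

  module _ {x₁ y₁ : Carrier} (e₁ : OnCurve x₁ y₁) (x₁≈2 : x₁ ≈ 2#) where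
    P : Point
    P = affine x₁ y₁ e₁

    open Algebra.Definitions.RawMonoid rawMonoid using () renaming (_×_ to _·_)

    y₁²≈ : y₁ * y₁ ≈ 2# * (2# - t)
    y₁²≈ = trans e₁ (trans (cubic-cong x₁≈2) (solve 1 (λ t →
      cubic⟨ t ⟩ (lit 2) := lit 2 :* (lit 2 :- t)) refl t))

    y₁≉0 : y₁ ≉ 0#
    y₁≉0 y₁≈0 = *-≉0 2≉0 (unit≉0 unit-2-t)
      (trans (sym y₁²≈) (trans (*-congˡ y₁≈0) (zeroʳ y₁)))

    collinear-2 : ∀ A → Collinear 2# y₁ A (-ₚ (P +ₚ A))
    collinear-2 A = Collinear-resp x₁≈2 (≈ₚ-refl _) (collinear-sum e₁ A)

    even-multiple : ∀ k → Even y₁ ((k ℕ.+ k) · P)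
    odd-multiple  : ∀ k → Odd y₁ (suc (k ℕ.+ k) · P)
    even-multiple zero = O
    even-multiple (suc k) rewrite ℕ.+-suc k k =
      odd⇒even y₁²≈ _ (odd-multiple k) (collinear-2 (suc (k ℕ.+ k) · P))
    odd-multiple k = even⇒odd y₁²≈ _ (even-multiple k) (collinear-2 ((k ℕ.+ k) · P))

    -- P + A ≈ C gives P - C ≈ - A: this replaces associativity.
    reflect : ∀ {n} → n · P ≈ₚ O → ∀ i j → i ℕ.+ j ≡ n → i · P ≈ₚ -ₚ (j · P)
    reflect nP≈O zero    j ≡.refl = O≈-ₚ nP≈O
      where
      O≈-ₚ : ∀ {A} → A ≈ₚ O → O ≈ₚ -ₚ A
      O≈-ₚ O≈O = O≈O
    -- The induction hypothesis puts iP in place of -(P + jP) on the line through P and jP.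
    reflect nP≈O (suc i) j i+j≡n = sum-collinear e₁ y₁≉0 2≉0
      (Collinear-resp refl (≈ₚ-sym (reflect nP≈O i (suc j) (≡.trans (ℕ.+-suc i j) i+j≡n)))
        (collinear-sum e₁ (j · P)))

    ≈-neg⇒≈0 : ∀ {y} → y ≈ - y → y ≈ 0#
    ≈-neg⇒≈0 {y} y≈-y = invertible⇒cancelˡ (proj₂ (≉0⇒invertible 2≉0)) (combine₁
      (solve 1 (λ y → lit 2 :* y :- lit 2 :* lit 0 := lit 1 :* (y :- (:- y))) refl y)
      y≈-y)

    odd≉neg : ∀ {A} → Odd y₁ A → ¬ A ≈ₚ -ₚ A
    odd≉neg (affine iu iθ _ y≈) (affine≈ _ y≈-y) =
      *-≉0 y₁≉0 (1+2integral≉0 iθ) (trans (sym y≈) (≈-neg⇒≈0 y≈-y))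

    -- An affine even point equal to its negative has y = 0, so x = 2y₁ζy = 0, against 8qx = 1.
    even≈neg⇒O : ∀ {A} → Even y₁ A → A ≈ₚ -ₚ A → A ≈ₚ O
    even≈neg⇒O O _ = O≈O
    even≈neg⇒O (affine _ _ 8qx≈1 x≈) (affine≈ _ y≈-y) = contradiction 1≈0 1≉0
      where
      1≈0 : 1# ≈ 0#
      1≈0 = trans (sym 8qx≈1) (trans
        (*-congˡ (trans x≈ (trans (*-congˡ (≈-neg⇒≈0 y≈-y)) (zeroʳ _)))) (zeroʳ _))

    odd≉O : ∀ {A} → Odd y₁ A → ¬ A ≈ₚ O
    odd≉O (affine _ _ _ _) ()

    data Parity : ℕ → Set where
      even : ∀ k → Parity (k ℕ.+ k)
      odd  : ∀ k → Parity (suc (k ℕ.+ k))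

    parity : ∀ n → Parity n
    parity zero = even 0
    parity (suc n) with parity n
    ... | even k = odd k
    ... | odd k  = ≡.subst Parity (ℕ.+-suc (suc k) k) (even (suc k))

    infinite-order : ∀ n → 0 < n → ¬ n · P ≈ₚ O
    infinite-order = <-rec _ descend
      where
      descend : ∀ n → (∀ {m} → m < n → 0 < m → ¬ m · P ≈ₚ O) → 0 < n → ¬ n · P ≈ₚ O
      descend n rec 0<n nP≈O with parity n
      ... | odd k  = odd≉O (odd-multiple k) nP≈O
      ... | even m with reflect nP≈O m m ≡.refl | parity m
      ...   | mP≈-mP | odd k  = odd≉neg (odd-multiple k) mP≈-mP
      ...   | mP≈-mP | even (suc k) =
        rec (ℕ.m<m+n _ (s≤s z≤n)) (s≤s z≤n) (even≈neg⇒O (even-multiple (suc k)) mP≈-mP)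
      -- Here m = 0 and n = 0, the one case in which halving does not decrease.
      ...   | _ | even zero = contradiction 0<n λ ()

theorem5 : Σ[ C ∈ ℕ ] 0 < C ×
    ((Q̄ : AlgebraicClosureOfℚ) →
    let open AlgebraicClosureOfℚ Q̄ in
    (t : Carrier) → IsRootOfUnity Q̄ t → t ≉ 1# →
    let open Legendre Q̄ t in
    (P : Point) → HasAbscissa (1# + 1#) P → HasFiniteOrder P →
    ∃[ d ] HasDegree Q̄ t d × d ≤ C)
-- Any positive bound serves: no point of abscissa 2 is torsion, so the degree bound follows from a
-- contradiction.
theorem5 = 1 , s≤s z≤n , λ where
  Q̄ t root t≉1 (Legendre.affine x y e) x≈2 (n , 0<n , nP≈O) →
    contradiction nP≈O (Multiples.infinite-order Q̄ t root t≉1 e x≈2 n 0<n)
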